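{- Let $W$ be a weighing matrix $W(23,16)$. Then the graph $\Gamma(W)$ contains at least one edge.
   Context: A weighing matrix $W(n,k)$ is an $n\times n$ matrix $W$ with entries in $\{0,1,-1\}$ whose rows are pairwise orthogonal and have length $\sqrt{k}$, i.e. $WW^T=kI_n$. For a weighing matrix $W$ of type $W(23,16)$ and $i\in\{1,\ldots,23\}$, let $L_i\subseteq\{1,\ldots,23\}$ (the $i$-th "line") be the set of column positions at which the $i$-th row of $W$ is zero. The graph $\Gamma(W)$ is the simple graph with vertex set $\{1,2,\ldots,23\}$ in which distinct $i$ and $j$ are joined by an edge if and only if $|L_i\cap L_j|=1$. -}

module Defs where

open import Algebra.Properties.Semiring.Sum using (sum-syntax)
open import Data.Bool.Base using (if_then_else_)
open import Data.Fin.Base using (Fin)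
open import Data.Fin.Properties using () renaming (_≟_ to _≟ᶠ_)
open import Data.Fin.Subset using (Subset; _∩_; ∣_∣)
open import Data.Fin.Subset.Properties using (∩-comm)
open import Data.Integer.Base using (ℤ; +_; 0ℤ; 1ℤ; -1ℤ; _*_)
open import Data.Integer.Properties using (_≟_; +-*-semiring)
open import Data.Nat.Base using (ℕ)
open import Data.Product.Base using (_×_; _,_; ∃₂)
open import Data.Sum.Base using (_⊎_)
open import Data.Vec.Base using (tabulate)
open import Data.Vec.Functional using (Vector; transpose)
open import Function.Base using (_∘_)
open import Level using (0ℓ)
open import Relation.Binary.Core using (Rel)
open import Relation.Binary.Definitions using (Symmetric; Irreflexive)
open import Relation.Binary.PropositionalEquality using (_≡_; _≢_; sym; trans; cong)
open import Relation.Nullary.Decidable using (does)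

Matrix : ℕ → ℕ → Set
Matrix m n = Vector (Vector ℤ n) m

infixl 7 _⊗_

_⊗_ : ∀ {l m n} → Matrix l m → Matrix m n → Matrix l n
_⊗_ {m = m} A B i j = sum-syntax +-*-semiring m (λ c → A i c * B c j)

identity : ∀ n → Matrix n n
identity n i j = if does (i ≟ᶠ j) then 1ℤ else 0ℤ

record IsWeighingMatrix (n k : ℕ) (W : Matrix n n) : Set where
  field
    entries : ∀ i j → W i j ≡ 0ℤ ⊎ W i j ≡ 1ℤ ⊎ W i j ≡ -1ℤ
    W⊗Wᵀ≡kI : ∀ i j → (W ⊗ transpose W) i j ≡ + k * identity n i j

record SimpleGraph (n : ℕ) : Set₁ where
  field
    Adjacent    : Rel (Fin n) 0ℓ
    symmetric   : Symmetric Adjacent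
    irreflexive : Irreflexive _≡_ Adjacent

HasEdge : ∀ {n} → SimpleGraph n → Set
HasEdge G = ∃₂ λ i j → SimpleGraph.Adjacent G i j

line : ∀ {n} → Matrix n n → Fin n → Subset n
line W i = tabulate (λ j → does (W i j ≟ 0ℤ))

Γ : ∀ {n} → Matrix n n → SimpleGraph n
Γ W = record
  { Adjacent    = λ i j → i ≢ j × ∣ line W i ∩ line W j ∣ ≡ 1
  ; symmetric   = λ {i} {j} (i≢j , eq) →
      i≢j ∘ sym , trans (cong ∣_∣ (∩-comm (line W j) (line W i))) eq
  ; irreflexive = λ i≡j (i≢j , _) → i≢j i≡j
  }

{-# OPTIONS --safe #-}

-- Orthogonality of two rows forces ∣Lᵢ ∩ Lⱼ∣ to have the parity of n = 23,
-- so without an edge any two distinct lines would meet in at least 3 points.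
-- But the columns of W also have weight 16, whence every point lies on exactly
-- 7 lines and Σⱼ ∣Lᵢ ∩ Lⱼ∣ = 7 · 7 = 49, which is less than 22 · 3.
module Submission where

open import Defs
open import Data.Bool.Base using (Bool; true; false; _∧_; if_then_else_)
open import Data.Fin.Base using (Fin; zero; suc)
open import Data.Fin.Properties using (any?; 0≢1+n) renaming (_≟_ to _≟ᶠ_)
open import Data.Fin.Subset using (_∩_; ∣_∣)
open import Data.Integer.Base
  using (ℤ; +_; -[1+_]; +[1+_]; 0ℤ; 1ℤ; -1ℤ; _+_; _*_; _-_; _≤_; +≤+)
  renaming (suc to sucℤ)
open import Data.Integer.Divisibility.Signed using (_∣_; divides; ∣m∣n⇒∣m+n; ∣m+n∣n⇒∣m; ∣⇒∣ᵤ)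
open import Data.Integer.Properties
  using ( _≟_; _≤?_; ≤-refl; ≤-antisym; +-*-semiring; +-mono-≤; +-monoʳ-≤
        ; +-identityˡ; +-identityʳ; +-inverseʳ; *-assoc; *-identityʳ; *-zeroˡ; *-zeroʳ
        ; suc-*; pos-*; *-cancelˡ-≤-pos; i≤j⇒0≤j-i; i-j≤0⇒i≤j )
open import Data.Integer.Tactic.RingSolver using (solve-∀)
open import Data.Nat.Base as ℕ using (ℕ; zero; suc; z≤n; s≤s)
import Data.Nat.Divisibility as ℕ
import Data.Nat.Properties as ℕ
open import Data.Product.Base using (_,_)
open import Data.Sum.Base using (_⊎_; inj₁; inj₂)
open import Data.Vec.Base using (tabulate)
open import Data.Vec.Functional using (Vector; transpose; replicate; _∷_)
open import Relation.Binary.PropositionalEquality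
open import Relation.Nullary.Decidable using (does; yes; no; dec-true; dec-false; from-no)
open import Relation.Nullary.Negation using (contradiction)
open import Algebra.Properties.Semiring.Sum +-*-semiring
  using (sum; sum-cong-≗; *-distribˡ-sum; *-distribʳ-sum; ∑-distrib-+; ∑-comm)

-- Finite integer sums and inequalities.

sum-const : ∀ n x → sum {n} (λ _ → x) ≡ + n * x
sum-const zero    x = sym (*-zeroˡ x)
sum-const (suc n) x = trans (cong (_+_ x) (sum-const n x)) (sym (suc-* (+ n) x))

sum-mono-≤ : ∀ {n} {f g : Vector ℤ n} → (∀ i → f i ≤ g i) → sum f ≤ sum g
sum-mono-≤ {zero}  f≤g = ≤-refl
sum-mono-≤ {suc n} f≤g = +-mono-≤ (f≤g zero) (sum-mono-≤ (λ i → f≤g (suc i)))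

sum-nonneg : ∀ {n} {f : Vector ℤ n} → (∀ i → 0ℤ ≤ f i) → 0ℤ ≤ sum f
sum-nonneg {zero}  0≤f = ≤-refl
sum-nonneg {suc n} 0≤f = +-mono-≤ (0≤f zero) (sum-nonneg (λ i → 0≤f (suc i)))

term≤sum : ∀ {n} {f : Vector ℤ n} → (∀ i → 0ℤ ≤ f i) → ∀ i → f i ≤ sum f
term≤sum {f = f} 0≤f zero = subst (_≤ sum f) (+-identityʳ (f zero))
  (+-monoʳ-≤ (f zero) (sum-nonneg (λ i → 0≤f (suc i))))
term≤sum {f = f} 0≤f (suc i) = subst (_≤ sum f) (+-identityˡ (f (suc i)))
  (+-mono-≤ (0≤f zero) (term≤sum (λ i → 0≤f (suc i)) i))

sum-∣ : ∀ {n d} {f : Vector ℤ n} → (∀ i → d ∣ f i) → d ∣ sum f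
sum-∣ {zero}  d∣f = divides 0ℤ refl
sum-∣ {suc n} d∣f = ∣m∣n⇒∣m+n (d∣f zero) (sum-∣ (λ i → d∣f (suc i)))

sum-*-identity : ∀ {n} (f : Vector ℤ n) i → sum (λ j → f j * identity n i j) ≡ f i
sum-*-identity {suc n} f zero = begin
  f zero * 1ℤ + sum (λ j → f (suc j) * 0ℤ)
    ≡⟨ cong₂ _+_ (*-identityʳ (f zero)) (sym (*-distribʳ-sum 0ℤ (λ j → f (suc j)))) ⟩
  f zero + sum (λ j → f (suc j)) * 0ℤ ≡⟨ cong (_+_ (f zero)) (*-zeroʳ (sum (λ j → f (suc j)))) ⟩
  f zero + 0ℤ                         ≡⟨ +-identityʳ (f zero) ⟩
  f zero                              ∎
  where open ≡-Reasoning
sum-*-identity {suc n} f (suc i) = begin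
  f zero * 0ℤ + sum (λ j → f (suc j) * identity n i j)
    ≡⟨ cong₂ _+_ (*-zeroʳ (f zero)) (sum-*-identity (λ j → f (suc j)) i) ⟩
  0ℤ + f (suc i) ≡⟨ +-identityˡ (f (suc i)) ⟩
  f (suc i)      ∎
  where open ≡-Reasoning

identity-diagonal : ∀ {n} (i : Fin n) → identity n i i ≡ 1ℤ
identity-diagonal i = cong (if_then 1ℤ else 0ℤ) (dec-true (i ≟ᶠ i) refl)

identity-off-diagonal : ∀ {n} {i j : Fin n} → i ≢ j → identity n i j ≡ 0ℤ
identity-off-diagonal {i = i} {j} i≢j = cong (if_then 1ℤ else 0ℤ) (dec-false (i ≟ᶠ j) i≢j)

square-nonneg : ∀ x → 0ℤ ≤ x * x
square-nonneg (+ n)    = subst (0ℤ ≤_) (pos-* n n) (+≤+ z≤n)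
square-nonneg -[1+ n ] = +≤+ z≤n

-- A positive `x` can be cancelled; for `x` zero the claim is just `0ℤ ≤ y`. This turns a bound on
-- the square of a column weight into a bound on the weight.
x*x≤x*y⇒x≤y : ∀ {x y} → 0ℤ ≤ x → 0ℤ ≤ y → x * x ≤ x * y → x ≤ y
x*x≤x*y⇒x≤y {+ zero}         _ 0≤y _ = 0≤y
x*x≤x*y⇒x≤y {+[1+ m ]} {y} _ _   h = *-cancelˡ-≤-pos +[1+ m ] y +[1+ m ] h

-- Zero positions as polynomials in the entries.

Ternary : ℤ → Set
Ternary x = x ≡ 0ℤ ⊎ x ≡ 1ℤ ⊎ x ≡ -1ℤ

-- On {0, 1, -1} this is the indicator function of 0.
zeroInd : ℤ → ℤ
zeroInd x = 1ℤ - x * x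

-- Replaces the Boolean test for a common zero by a product, so that counting common points becomes
-- manipulation of integer sums.
zeroInd-∧ : ∀ {x y} → Ternary x → Ternary y →
            (if does (x ≟ 0ℤ) ∧ does (y ≟ 0ℤ) then 1ℤ else 0ℤ) ≡ zeroInd x * zeroInd y
zeroInd-∧ (inj₁ refl)        (inj₁ refl)        = refl
zeroInd-∧ (inj₁ refl)        (inj₂ (inj₁ refl)) = refl
zeroInd-∧ (inj₁ refl)        (inj₂ (inj₂ refl)) = refl
zeroInd-∧ (inj₂ (inj₁ refl)) _                  = refl
zeroInd-∧ (inj₂ (inj₂ refl)) _                  = refl

-- The expression expands to `2 + xy(xy + 1)`, and two consecutive integers have an even product.
-- The summands are chosen so that adding over all columns produces the order, an intersection size,
-- two row weights and an inner product of rows.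
zeroInd-even : ∀ {x y} → Ternary x → Ternary y →
               + 2 ∣ (1ℤ + zeroInd x * zeroInd y) + ((x * x + y * y) + x * y)
zeroInd-even (inj₁ refl)        (inj₁ refl)        = divides 1ℤ refl
zeroInd-even (inj₁ refl)        (inj₂ (inj₁ refl)) = divides 1ℤ refl
zeroInd-even (inj₁ refl)        (inj₂ (inj₂ refl)) = divides 1ℤ refl
zeroInd-even (inj₂ (inj₁ refl)) (inj₁ refl)        = divides 1ℤ refl
zeroInd-even (inj₂ (inj₁ refl)) (inj₂ (inj₁ refl)) = divides (+ 2) refl
zeroInd-even (inj₂ (inj₁ refl)) (inj₂ (inj₂ refl)) = divides 1ℤ refl
zeroInd-even (inj₂ (inj₂ refl)) (inj₁ refl)        = divides 1ℤ refl
zeroInd-even (inj₂ (inj₂ refl)) (inj₂ (inj₁ refl)) = divides 1ℤ refl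
zeroInd-even (inj₂ (inj₂ refl)) (inj₂ (inj₂ refl)) = divides (+ 2) refl

sum-zeroInd : ∀ {n} (f : Vector ℤ n) → sum (λ i → zeroInd (f i)) ≡ + n - sum (λ i → f i * f i)
sum-zeroInd {n} f = begin
  z                ≡⟨ cancel z s ⟩
  z + s - s        ≡⟨ cong (_- s) (∑-distrib-+ (λ i → zeroInd (f i)) (λ i → f i * f i)) ⟨
  sum (λ i → zeroInd (f i) + f i * f i) - s
    ≡⟨ cong (_- s) (sum-cong-≗ (λ i → sym (uncancel 1ℤ (f i * f i)))) ⟩
  sum {n} (λ _ → 1ℤ) - s ≡⟨ cong (_- s) (trans (sum-const n 1ℤ) (*-identityʳ (+ n))) ⟩
  + n - s          ∎
  where
  open ≡-Reasoning
  z = sum (λ i → zeroInd (f i))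
  s = sum (λ i → f i * f i)
  cancel : ∀ a b → a ≡ a + b - b
  cancel = solve-∀
  uncancel : ∀ a b → a ≡ a - b + b
  uncancel = solve-∀

∣tabulate-∩∣ : ∀ {n} (f g : Fin n → Bool) →
               + ∣ tabulate f ∩ tabulate g ∣ ≡ sum (λ i → if f i ∧ g i then 1ℤ else 0ℤ)
∣tabulate-∩∣ {zero}  f g = refl
∣tabulate-∩∣ {suc n} f g with f zero ∧ g zero | ∣tabulate-∩∣ (λ i → f (suc i)) (λ i → g (suc i))
... | true  | ih = cong sucℤ ih
... | false | ih = trans ih (sym (+-identityˡ _))

-- Column weights of a weighing matrix.

module WeighingMatrix {n k : ℕ} {W : Matrix n n} (isW : IsWeighingMatrix n k W) where

  open IsWeighingMatrix isW

  row-weight : ∀ i → sum (λ c → W i c * W i c) ≡ + k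
  row-weight i = trans (W⊗Wᵀ≡kI i i)
    (trans (cong (+ k *_) (identity-diagonal i)) (*-identityʳ (+ k)))

  rows-orthogonal : ∀ {i j} → i ≢ j → sum (λ c → W i c * W j c) ≡ 0ℤ
  rows-orthogonal {i} {j} i≢j = trans (W⊗Wᵀ≡kI i j)
    (trans (cong (+ k *_) (identity-off-diagonal i≢j)) (*-zeroʳ (+ k)))

  -- Associativity: regrouping the triple product exposes `W ⊗ transpose W`, which is `k` times the
  -- identity. Information about rows thus reaches the column Gram matrix without inverting `W`.
  WWᵀW≡kW : ∀ i c → sum (λ d → W i d * (transpose W ⊗ W) c d) ≡ + k * W i c
  WWᵀW≡kW i c = begin
    sum (λ d → W i d * sum (λ j → W j c * W j d))
      ≡⟨ sum-cong-≗ (λ d → *-distribˡ-sum (W i d) (λ j → W j c * W j d)) ⟩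
    sum (λ d → sum (λ j → W i d * (W j c * W j d)))
      ≡⟨ ∑-comm (λ d j → W i d * (W j c * W j d)) ⟩
    sum (λ j → sum (λ d → W i d * (W j c * W j d)))
      ≡⟨ sum-cong-≗ (λ j → sum-cong-≗ (λ d → swap (W i d) (W j c) (W j d))) ⟩
    sum (λ j → sum (λ d → W j c * (W i d * W j d)))
      ≡⟨ sum-cong-≗ (λ j → sym (*-distribˡ-sum (W j c) (λ d → W i d * W j d))) ⟩
    sum (λ j → W j c * (W ⊗ transpose W) i j)
      ≡⟨ sum-cong-≗ (λ j → cong (W j c *_) (W⊗Wᵀ≡kI i j)) ⟩
    sum (λ j → W j c * (+ k * identity n i j))
      ≡⟨ sum-cong-≗ (λ j → swap (W j c) (+ k) (identity n i j)) ⟩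
    sum (λ j → + k * (W j c * identity n i j))
      ≡⟨ *-distribˡ-sum (+ k) (λ j → W j c * identity n i j) ⟨
    + k * sum (λ j → W j c * identity n i j)
      ≡⟨ cong (+ k *_) (sum-*-identity (λ j → W j c) i) ⟩
    + k * W i c ∎
    where
    open ≡-Reasoning
    swap : ∀ x y z → x * (y * z) ≡ y * (x * z)
    swap = solve-∀

  -- Multiplying the previous identity by the transpose of `W` shows that the column Gram matrix `P`
  -- satisfies `P² = kP`; this is a diagonal entry. As `P` is symmetric, the left side is the sum of
  -- squares of one of its rows.
  WᵀWWᵀW-diagonal : ∀ c → sum (λ d → (transpose W ⊗ W) c d * (transpose W ⊗ W) c d)
                          ≡ (transpose W ⊗ W) c c * + k
  WᵀWWᵀW-diagonal c = begin
    sum (λ d → P d * P d)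
      ≡⟨ sum-cong-≗ (λ d → *-distribʳ-sum (P d) (λ i → W i c * W i d)) ⟩
    sum (λ d → sum (λ i → W i c * W i d * P d))
      ≡⟨ ∑-comm (λ d i → W i c * W i d * P d) ⟩
    sum (λ i → sum (λ d → W i c * W i d * P d))
      ≡⟨ sum-cong-≗ (λ i → sum-cong-≗ (λ d → *-assoc (W i c) (W i d) (P d))) ⟩
    sum (λ i → sum (λ d → W i c * (W i d * P d)))
      ≡⟨ sum-cong-≗ (λ i → sym (*-distribˡ-sum (W i c) (λ d → W i d * P d))) ⟩
    sum (λ i → W i c * sum (λ d → W i d * P d))
      ≡⟨ sum-cong-≗ (λ i → cong (W i c *_) (WWᵀW≡kW i c)) ⟩
    sum (λ i → W i c * (+ k * W i c))
      ≡⟨ sum-cong-≗ (λ i → rotate (W i c) (+ k)) ⟩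
    sum (λ i → W i c * W i c * + k)
      ≡⟨ *-distribʳ-sum (+ k) (λ i → W i c * W i c) ⟨
    P c * + k ∎
    where
    open ≡-Reasoning
    P = (transpose W ⊗ W) c
    rotate : ∀ x y → x * (y * x) ≡ x * x * y
    rotate = solve-∀

  columnWeight : Fin n → ℤ
  columnWeight c = sum (λ i → W i c * W i c)

  -- The term `d = c` in that sum of squares is the squared column weight, so the square is at most
  -- `k` times the weight.
  columnWeight≤k : ∀ c → columnWeight c ≤ + k
  columnWeight≤k c = x*x≤x*y⇒x≤y (sum-nonneg (λ i → square-nonneg (W i c))) (+≤+ z≤n)
    (subst (columnWeight c * columnWeight c ≤_) (WᵀWWᵀW-diagonal c)
      (term≤sum (λ d → square-nonneg ((transpose W ⊗ W) c d)) c))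

  -- The column weights are at most k and have average k.
  columnWeight≡k : ∀ c → columnWeight c ≡ + k
  columnWeight≡k c = ≤-antisym (columnWeight≤k c) (i-j≤0⇒i≤j
    (subst (+ k - columnWeight c ≤_) deficit (term≤sum (λ d → i≤j⇒0≤j-i (columnWeight≤k d)) c)))
    where
    open ≡-Reasoning
    cancel : ∀ a b → a ≡ a + b - b
    cancel = solve-∀
    uncancel : ∀ a b → a - b + b ≡ a
    uncancel = solve-∀
    D = sum (λ d → + k - columnWeight d)
    K = sum columnWeight
    total : K ≡ sum {n} (λ _ → + k)
    -- The squares of all entries are added by rows instead of by columns.
    total = trans (∑-comm (λ c i → W i c * W i c)) (sum-cong-≗ row-weight)
    deficit : D ≡ 0ℤ
    deficit = begin
      D         ≡⟨ cancel D K ⟩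
      D + K - K ≡⟨ cong (_- K) (∑-distrib-+ (λ d → + k - columnWeight d) columnWeight) ⟨
      sum (λ d → + k - columnWeight d + columnWeight d) - K
        ≡⟨ cong (_- K) (trans (sum-cong-≗ (λ d → uncancel (+ k) (columnWeight d))) (sym total)) ⟩
      K - K     ≡⟨ +-inverseʳ K ⟩
      0ℤ        ∎

  -- Intersections of lines.

  meet : Fin n → Fin n → ℕ
  meet i j = ∣ line W i ∩ line W j ∣

  meet-sum : ∀ i j → + meet i j ≡ sum (λ c → zeroInd (W i c) * zeroInd (W j c))
  meet-sum i j = trans
    (∣tabulate-∩∣ (λ c → does (W i c ≟ 0ℤ)) (λ c → does (W j c ≟ 0ℤ)))
    (sum-cong-≗ (λ c → zeroInd-∧ (entries i c) (entries j c)))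

  -- Adding `zeroInd-even` over all columns gives an even total that exceeds `n + meet i j` by `2k`,
  -- because the inner product of the two rows vanishes.
  meet-parity : ∀ {i j} → i ≢ j → + 2 ∣ + (n ℕ.+ meet i j)
  meet-parity {i} {j} i≢j = ∣m+n∣n⇒∣m
    (subst (+ 2 ∣_) total (sum-∣ (λ c → zeroInd-even (entries i c) (entries j c))))
    -- The two copies of `k` are the row weights; the final `0ℤ` is the inner product.
    (divides (+ k) (double (+ k)))
    where
    open ≡-Reasoning
    double : ∀ x → x + x + 0ℤ ≡ x * + 2
    double = solve-∀
    z : Fin n → ℤ
    z c = zeroInd (W i c) * zeroInd (W j c)
    total : sum (λ c → (1ℤ + z c) + ((W i c * W i c + W j c * W j c) + W i c * W j c))
            ≡ + n + + meet i j + (+ k + + k + 0ℤ)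
    total = begin
      _ ≡⟨ ∑-distrib-+ (λ c → 1ℤ + z c)
             (λ c → (W i c * W i c + W j c * W j c) + W i c * W j c) ⟩
      _ ≡⟨ cong₂ _+_ (∑-distrib-+ (λ _ → 1ℤ) z)
             (∑-distrib-+ (λ c → W i c * W i c + W j c * W j c) (λ c → W i c * W j c)) ⟩
      _ ≡⟨ cong₂ _+_
             (cong₂ _+_ (trans (sum-const n 1ℤ) (*-identityʳ (+ n))) (sym (meet-sum i j)))
             (cong₂ _+_ (trans (∑-distrib-+ (λ c → W i c * W i c) (λ c → W j c * W j c))
                          (cong₂ _+_ (row-weight i) (row-weight j)))
                        (rows-orthogonal i≢j)) ⟩
      _ ∎

  -- Counts pairs of a line and a point it shares with line `i`: that line has `n - k` points, each
  -- on `n - k` lines by `columnWeight≡k`. The case `j = i` is included.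
  meet-total : ∀ i → sum (λ j → + meet i j) ≡ (+ n - + k) * (+ n - + k)
  meet-total i = begin
    sum (λ j → + meet i j)
      ≡⟨ sum-cong-≗ (meet-sum i) ⟩
    sum (λ j → sum (λ c → zeroInd (W i c) * zeroInd (W j c)))
      ≡⟨ ∑-comm (λ j c → zeroInd (W i c) * zeroInd (W j c)) ⟩
    sum (λ c → sum (λ j → zeroInd (W i c) * zeroInd (W j c)))
      ≡⟨ sum-cong-≗ (λ c → sym (*-distribˡ-sum (zeroInd (W i c)) (λ j → zeroInd (W j c)))) ⟩
    sum (λ c → zeroInd (W i c) * sum (λ j → zeroInd (W j c)))
      ≡⟨ sum-cong-≗ (λ c → cong (zeroInd (W i c) *_)
           (trans (sum-zeroInd (λ j → W j c)) (cong (_-_ (+ n)) (columnWeight≡k c)))) ⟩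
    sum (λ c → zeroInd (W i c) * (+ n - + k))
      ≡⟨ *-distribʳ-sum (+ n - + k) (λ c → zeroInd (W i c)) ⟨
    sum (λ c → zeroInd (W i c)) * (+ n - + k)
      ≡⟨ cong (_* (+ n - + k)) (trans (sum-zeroInd (W i)) (cong (_-_ (+ n)) (row-weight i))) ⟩
    (+ n - + k) * (+ n - + k) ∎
    where open ≡-Reasoning

-- The case of order 23 and weight 16.

2∣23+m∧m≢1⇒3≤m : ∀ m → 2 ℕ.∣ 23 ℕ.+ m → m ≢ 1 → 3 ℕ.≤ m
2∣23+m∧m≢1⇒3≤m 0 2∣23 _   = contradiction 2∣23 (from-no (2 ℕ.∣? 23))
2∣23+m∧m≢1⇒3≤m 1 _    m≢1 = contradiction refl m≢1
2∣23+m∧m≢1⇒3≤m 2 2∣25 _   = contradiction 2∣25 (from-no (2 ℕ.∣? 25))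
2∣23+m∧m≢1⇒3≤m (suc (suc (suc m))) _ _ = s≤s (s≤s (s≤s z≤n))

proposition1 : (W : Matrix 23 23) → IsWeighingMatrix 23 16 W → HasEdge (Γ W)
-- An edge is sought only at vertex `zero`; the counting argument already succeeds for a single
-- fixed line.
proposition1 W isW with any? (λ j → WeighingMatrix.meet isW zero (suc j) ℕ.≟ 1)
... | yes (j , eq) = zero , suc j , 0≢1+n , eq
... | no ¬edge = contradiction
  -- Here 66 is `22 · 3`, the sum of the lower bounds, and 49 is `(23 - 16)²`.
  (subst (+ 66 ≤_) (meet-total zero) (sum-mono-≤ lower-bound))
  (from-no (+ 66 ≤? + 49))
  where
  open WeighingMatrix isW
  -- The intersection of line `zero` with itself gets only the trivial bound 0, which suffices.
  lower-bound : ∀ j → (0ℤ ∷ replicate 22 (+ 3)) j ≤ + meet zero j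
  lower-bound zero    = +≤+ z≤n
  lower-bound (suc j) = +≤+ (2∣23+m∧m≢1⇒3≤m (meet zero (suc j))
    (∣⇒∣ᵤ (meet-parity 0≢1+n)) (λ eq → ¬edge (j , eq)))
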